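{- Let $k\ge1$. The logic $\mathbb{L}_k^{\le}$ is finitely equivalential, with set of equivalence formulas $E(p,q)=\{\delta(p,q)\}$, and hence protoalgebraic; but $\mathbb{L}_k^{\le}$ is not algebraizable in the sense of Blok and Pigozzi.
   Context: A modal pseudocomplemented De Morgan algebra ($mpM$-algebra) is an algebra $\langle A,\wedge,\vee,\sim,{}^\ast,0,1\rangle$ such that $\langle A,\wedge,\vee,\sim,0,1\rangle$ is a De Morgan algebra (bounded distributive lattice with $\sim\sim x=x$, $\sim(x\vee y)=\sim x\wedge\sim y$), $x^\ast$ is the pseudocomplement of $x$, and $x\vee\sim x\le x\vee x^\ast$. A $\mathcal{C}_k$-algebra ($k\ge1$) is a pair $(A,t)$ with $A$ an $mpM$-algebra and $t$ an $mpM$-automorphism of $A$ with $t^k=\mathrm{id}$. $Fm$ is the set of formulas built from a denumerable set of variables with connectives $\wedge,\vee$ (binary), $\sim,{}^\ast,t$ (unary), $\top,\bot$ (constants); a valuation into $(A,t)$ is a homomorphism $v:Fm\to(A,t)$ (with $v(\top)=1$, $v(\bot)=0$). The degree-preserving logic $\mathbb{L}_k^{\le}=\langle Fm,\models_k^{\le}\rangle$: for nonempty finite $\{\alpha_1,\dots,\alpha_n\}$, $\alpha_1,\dots,\alpha_n\models_k^{\le}\alpha$ iff for every $\mathcal{C}_k$-algebra $(A,t)$, every valuation $v$ and every $a\in A$, if $v(\alpha_i)\ge a$ for all $i$ then $v(\alpha)\ge a$; $\emptyset\models_k^{\le}\alpha$ iff $v(\alpha)=1$ for all $(A,t)$ and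 $v$; for infinite $\Gamma$, $\Gamma\models_k^{\le}\alpha$ iff some finite nonempty subset entails $\alpha$. Define $x\to y=\sim\big((\sim(x\vee y))^\ast\wedge(x\vee y)\big)\vee\big((\sim(x\wedge y))^\ast\wedge(x\wedge y)\big)$, $x\leftrightarrow y=(x\to y)\wedge(\sim y\to\sim x)$, and $\delta(p,q)=\bigwedge_{i=0}^{k-1}(t^ip\leftrightarrow t^iq)$. A logic $L$ is finitely equivalential if there is a finite set $E(p,q)$ of formulas in two variables with: (E1) $\vdash_L\varepsilon(p,p)$ for all $\varepsilon\in E$; (E2) $E(p,q)\cup\{p\}\vdash_L q$; (E3) for every $n$-ary connective $\#$, $E(p_1,q_1)\cup\dots\cup E(p_n,q_n)\vdash_L E(\#(p_1,\dots,p_n),\#(q_1,\dots,q_n))$. $L$ is protoalgebraic if for every algebra $\mathbf A$ the Leibniz operator $F\mapsto\boldsymbol\Omega_{\mathbf A}F$ (largest congruence compatible with $F$) is monotone on $L$-filters of $\mathbf A$. $L$ is algebraizable (Blok–Pigozzi) if there are a set of equivalence formulas $\Delta(p,q)$ and defining equations $E(p)$ satisfying the standard conditions, equivalently the Leibniz operator is a lattice isomorphism between $L$-filters and relative congruences on every algebra. -}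

module Defs where

open import Algebra.Core using (Op₁; Op₂)
open import Algebra.Definitions using (Congruent₁; RightIdentity; Involutive)
open import Algebra.Lattice.Structures using (IsDistributiveLattice)
open import Data.Fin.Base using (Fin; zero; suc)
open import Data.List.Base using (List; []; _∷_; map)
open import Data.List.Membership.Propositional using (_∈_)
open import Data.List.Relation.Unary.All as All using (All; []; _∷_)
open import Data.Nat.Base using (ℕ; zero; suc)
open import Data.Nat.GeneralisedArithmetic using (fold)
open import Data.Product.Base using (Σ-syntax; ∃-syntax; _×_; _,_)
open import Data.Vec.Base using ([]; _∷_; lookup)
open import Function.Bundles using (_⇔_; mk⇔; Equivalence)
open import Function.Definitions using (Bijective)
open import Level using (Level; 0ℓ; _⊔_) renaming (suc to lsuc)
open import Relation.Binary.Construct.NaturalOrder.Left as NaturalOrder using ()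
open import Relation.Binary.Core using (Rel; _⇒_)
open import Relation.Binary.PropositionalEquality as ≡ using (_≡_)
open import Relation.Binary.Structures using (IsEquivalence)
open import Relation.Unary using (Pred; ∅; ｛_｝; _∪_; _⊆_; Satisfiable)

private variable
  a r f e s c ℓ κ : Level
  V : Set

record Algebra a r : Set (lsuc (a ⊔ r)) where
  infixr 7 _∧_
  infixr 6 _∨_
  infix  8 ∼_
  infix  9 _*
  infix  4 _≈_
  field
    Carrier       : Set a
    _≈_           : Rel Carrier r
    _∧_ _∨_       : Op₂ Carrier
    ∼_ _* t       : Op₁ Carrier
    ⊤ ⊥           : Carrier
    isEquivalence : IsEquivalence _≈_
    ∧-cong        : ∀ {x x′ y y′} → x ≈ x′ → y ≈ y′ → x ∧ y ≈ x′ ∧ y′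
    ∨-cong        : ∀ {x x′ y y′} → x ≈ x′ → y ≈ y′ → x ∨ y ≈ x′ ∨ y′
    ∼-cong        : ∀ {x x′} → x ≈ x′ → ∼ x ≈ ∼ x′
    *-cong        : ∀ {x x′} → x ≈ x′ → x * ≈ x′ *
    t-cong        : ∀ {x x′} → x ≈ x′ → t x ≈ t x′

record IsCongruence (A : Algebra a r) (θ : Rel (Algebra.Carrier A) e) : Set (a ⊔ r ⊔ e) where
  open Algebra A using (Carrier; _≈_; _∧_; _∨_; ∼_; _*; t)
  field
    isEquivalence : IsEquivalence θ
    reflexive     : ∀ {x y} → x ≈ y → θ x y
    ∧-cong        : ∀ {x x′ y y′} → θ x x′ → θ y y′ → θ (x ∧ y) (x′ ∧ y′)
    ∨-cong        : ∀ {x x′ y y′} → θ x x′ → θ y y′ → θ (x ∨ y) (x′ ∨ y′)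
    ∼-cong        : ∀ {x x′} → θ x x′ → θ (∼ x) (∼ x′)
    *-cong        : ∀ {x x′} → θ x x′ → θ (x *) (x′ *)
    t-cong        : ∀ {x x′} → θ x x′ → θ (t x) (t x′)

Compatible : {X : Set a} → Rel X e → Pred X f → Set (a ⊔ e ⊔ f)
Compatible θ F = ∀ {x y} → θ x y → F x → F y

-- θ = Ω_A F, the largest congruence of A compatible with F.
record IsLeibniz (A : Algebra a r) (F : Pred (Algebra.Carrier A) f)
                 (θ : Rel (Algebra.Carrier A) e) : Set (a ⊔ r ⊔ f ⊔ lsuc e) where
  field
    isCongruence : IsCongruence A θ
    compatible   : Compatible θ F
    largest      : (θ′ : Rel (Algebra.Carrier A) e) →
                   IsCongruence A θ′ → Compatible θ′ F → θ′ ⇒ θ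

module _ (A : Algebra a r) where
  open Algebra A using (Carrier; _≈_; _∧_; _∨_; ∼_; _*; t; isEquivalence; ∧-cong; ∨-cong; ∼-cong; *-cong; t-cong)

  -- Composites of elementary translations; the outermost constructor is the
  -- translation applied first.
  data Translation : Set a where
    □                    : Translation
    ∧ˡ ∧ʳ ∨ˡ ∨ʳ          : Carrier → Translation → Translation
    ∼-then *-then t-then : Translation → Translation

  apply : Translation → Carrier → Carrier
  apply □          x = x
  apply (∧ˡ b π)   x = apply π (x ∧ b)
  apply (∧ʳ b π)   x = apply π (b ∧ x)
  apply (∨ˡ b π)   x = apply π (x ∨ b)
  apply (∨ʳ b π)   x = apply π (b ∨ x)
  apply (∼-then π) x = apply π (∼ x)
  apply (*-then π) x = apply π (x *)
  apply (t-then π) x = apply π (t x)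

  module _ {θ : Rel Carrier e} (θ-cong : IsCongruence A θ) where
    private
      module θ = IsCongruence θ-cong
      θ-refl : ∀ {x} → θ x x
      θ-refl = IsEquivalence.refl θ.isEquivalence

    apply-cong : ∀ π {x y} → θ x y → θ (apply π x) (apply π y)
    apply-cong □          xy = xy
    apply-cong (∧ˡ b π)   xy = apply-cong π (θ.∧-cong xy θ-refl)
    apply-cong (∧ʳ b π)   xy = apply-cong π (θ.∧-cong θ-refl xy)
    apply-cong (∨ˡ b π)   xy = apply-cong π (θ.∨-cong xy θ-refl)
    apply-cong (∨ʳ b π)   xy = apply-cong π (θ.∨-cong θ-refl xy)
    apply-cong (∼-then π) xy = apply-cong π (θ.∼-cong xy)
    apply-cong (*-then π) xy = apply-cong π (θ.*-cong xy)
    apply-cong (t-then π) xy = apply-cong π (θ.t-cong xy)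

  ≈-isCongruence : IsCongruence A _≈_
  ≈-isCongruence = record
    { isEquivalence = isEquivalence ; reflexive = λ xy → xy
    ; ∧-cong = ∧-cong ; ∨-cong = ∨-cong
    ; ∼-cong = ∼-cong ; *-cong = *-cong ; t-cong = t-cong }

  Ω : Pred Carrier f → Rel Carrier (a ⊔ f)
  Ω F x y = ∀ π → F (apply π x) ⇔ F (apply π y)

  Ω-isLeibniz : {F : Pred Carrier f} → (∀ {x y} → x ≈ y → F x → F y) → IsLeibniz A F (Ω F)
  Ω-isLeibniz {F = F} resp = record
    { isCongruence = record
      { isEquivalence = record { refl = Ω-refl ; sym = Ω-sym ; trans = Ω-trans }
      ; reflexive = λ xy → below ≈-isCongruence resp xy
      ; ∧-cong = λ {x} {x′} {y} {y′} p q → Ω-trans (λ π → p (∧ˡ y π)) (λ π → q (∧ʳ x′ π))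
      ; ∨-cong = λ {x} {x′} {y} {y′} p q → Ω-trans (λ π → p (∨ˡ y π)) (λ π → q (∨ʳ x′ π))
      ; ∼-cong = λ p π → p (∼-then π)
      ; *-cong = λ p π → p (*-then π)
      ; t-cong = λ p π → p (t-then π)
      }
    ; compatible = λ p → Equivalence.to (p □)
    ; largest = λ _ θ-cong θ-comp → below θ-cong θ-comp
    }
    where
    Ω-refl : ∀ {x} → Ω F x x
    Ω-refl π = mk⇔ (λ p → p) (λ p → p)
    Ω-sym : ∀ {x y} → Ω F x y → Ω F y x
    Ω-sym p π = mk⇔ (Equivalence.from (p π)) (Equivalence.to (p π))
    Ω-trans : ∀ {x y z} → Ω F x y → Ω F y z → Ω F x z
    Ω-trans p q π = mk⇔ (λ Fx → Equivalence.to (q π) (Equivalence.to (p π) Fx))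
                        (λ Fz → Equivalence.from (p π) (Equivalence.from (q π) Fz))
    below : ∀ {e} {θ : Rel Carrier e} → IsCongruence A θ → Compatible θ F → θ ⇒ Ω F
    below θ-cong θ-comp xy π = mk⇔
      (θ-comp (apply-cong θ-cong π xy))
      (θ-comp (apply-cong θ-cong π (IsEquivalence.sym (IsCongruence.isEquivalence θ-cong) xy)))

record IsDeMorganAlgebra {A : Set c} (_≈_ : Rel A ℓ) (_∨_ _∧_ : Op₂ A)
                         (∼_ : Op₁ A) (1# 0# : A) : Set (c ⊔ ℓ) where
  field
    isDistributiveLattice : IsDistributiveLattice _≈_ _∨_ _∧_
    ∧-identityʳ           : RightIdentity _≈_ 1# _∧_
    ∨-identityʳ           : RightIdentity _≈_ 0# _∨_
    ∼-cong                : Congruent₁ _≈_ ∼_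
    ∼-involutive          : Involutive _≈_ ∼_
    ∼-∨                   : ∀ x y → (∼ (x ∨ y)) ≈ ((∼ x) ∧ (∼ y))

  open IsDistributiveLattice isDistributiveLattice public

record MpMAlgebra c ℓ : Set (lsuc (c ⊔ ℓ)) where
  infixr 7 _∧_
  infixr 6 _∨_
  infix  8 ∼_
  infix  9 _*
  infix  4 _≈_
  field
    Carrier           : Set c
    _≈_               : Rel Carrier ℓ
    _∧_ _∨_           : Op₂ Carrier
    ∼_ _*             : Op₁ Carrier
    1# 0#             : Carrier
    isDeMorganAlgebra : IsDeMorganAlgebra _≈_ _∨_ _∧_ ∼_ 1# 0#

  open IsDeMorganAlgebra isDeMorganAlgebra public
  open NaturalOrder _≈_ _∧_ public using (_≤_)

  field
    *-cong           : Congruent₁ _≈_ _*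
    *-pseudocompl    : ∀ x y → (x ∧ y ≈ 0#) ⇔ (y ≤ x *)
    x∨∼x≤x∨x*        : ∀ x → x ∨ ∼ x ≤ x ∨ x *

record IsMpMAutomorphism (M : MpMAlgebra c ℓ)
                         (h : Op₁ (MpMAlgebra.Carrier M)) : Set (c ⊔ ℓ) where
  open MpMAlgebra M
  field
    cong      : Congruent₁ _≈_ h
    ∧-homo    : ∀ x y → h (x ∧ y) ≈ h x ∧ h y
    ∨-homo    : ∀ x y → h (x ∨ y) ≈ h x ∨ h y
    ∼-homo    : ∀ x → h (∼ x) ≈ ∼ h x
    *-homo    : ∀ x → h (x *) ≈ h x *
    1#-homo   : h 1# ≈ 1#
    0#-homo   : h 0# ≈ 0#
    bijective : Bijective _≈_ _≈_ h

record CAlgebra (k : ℕ) c ℓ : Set (lsuc (c ⊔ ℓ)) where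
  field
    mpMAlgebra : MpMAlgebra c ℓ

  open MpMAlgebra mpMAlgebra public

  field
    t              : Op₁ Carrier
    isAutomorphism : IsMpMAutomorphism mpMAlgebra t
    t^k≈id         : ∀ x → fold x t k ≈ x

  algebra : Algebra c ℓ
  algebra = record
    { Carrier = Carrier ; _≈_ = _≈_
    ; _∧_ = _∧_ ; _∨_ = _∨_ ; ∼_ = ∼_ ; _* = _* ; t = t ; ⊤ = 1# ; ⊥ = 0#
    ; isEquivalence = isEquivalence
    ; ∧-cong = ∧-cong ; ∨-cong = ∨-cong
    ; ∼-cong = ∼-cong ; *-cong = *-cong
    ; t-cong = IsMpMAutomorphism.cong isAutomorphism
    }

infixr 7 _∧_
infixr 6 _∨_
infix  8 ∼_
infix  9 _*
infixr 5 _⟶_ _⟷_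

data Term (V : Set) : Set where
  var     : V → Term V
  _∧_ _∨_ : Term V → Term V → Term V
  ∼_ _* t : Term V → Term V
  ⊤ ⊥     : Term V

Fm : Set
Fm = Term ℕ

Terms : Set → Algebra 0ℓ 0ℓ
Terms V = record
  { Carrier = Term V ; _≈_ = _≡_
  ; _∧_ = _∧_ ; _∨_ = _∨_ ; ∼_ = ∼_ ; _* = _* ; t = t ; ⊤ = ⊤ ; ⊥ = ⊥
  ; isEquivalence = ≡.isEquivalence
  ; ∧-cong = ≡.cong₂ _∧_ ; ∨-cong = ≡.cong₂ _∨_
  ; ∼-cong = ≡.cong ∼_ ; *-cong = ≡.cong _* ; t-cong = ≡.cong t
  }

-- Terms V is absolutely free, so the homomorphisms Terms V → A are exactly
-- the maps eval A v, one for each assignment v : V → A.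
eval : (A : Algebra a r) → (V → Algebra.Carrier A) → Term V → Algebra.Carrier A
eval A v (var x) = v x
eval A v (φ ∧ ψ) = Algebra._∧_ A (eval A v φ) (eval A v ψ)
eval A v (φ ∨ ψ) = Algebra._∨_ A (eval A v φ) (eval A v ψ)
eval A v (∼ φ)   = Algebra.∼_ A (eval A v φ)
eval A v (φ *)   = Algebra._* A (eval A v φ)
eval A v (t φ)   = Algebra.t A (eval A v φ)
eval A v ⊤       = Algebra.⊤ A
eval A v ⊥       = Algebra.⊥ A

Fm₁ Fm₂ : Set
Fm₁ = Term (Fin 1)
Fm₂ = Term (Fin 2)

_[_]₁ : Fm₁ → Fm → Fm
ε [ φ ]₁ = eval (Terms ℕ) (lookup (φ ∷ [])) ε

_[_,_]₂ : Fm₂ → Fm → Fm → Fm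
ε [ φ , ψ ]₂ = eval (Terms ℕ) (lookup (φ ∷ ψ ∷ [])) ε

_⟶_ _⟷_ : Term V → Term V → Term V
x ⟶ y = ∼ ((∼ (x ∨ y)) * ∧ (x ∨ y)) ∨ ((∼ (x ∧ y)) * ∧ (x ∧ y))
x ⟷ y = (x ⟶ y) ∧ (∼ y ⟶ ∼ x)

-- ⋀ n f = f 0 ∧ … ∧ f (n - 1)
⋀ : ℕ → (ℕ → Term V) → Term V
⋀ zero          f = ⊤
⋀ (suc zero)    f = f 0
⋀ (suc (suc n)) f = ⋀ (suc n) f ∧ f (suc n)

δ : ℕ → Fm₂
δ k = ⋀ k (λ i → fold p t i ⟷ fold q t i)
  where
  p q : Fm₂
  p = var zero
  q = var (suc zero)

Consequence : ∀ s → Set (lsuc (0ℓ ⊔ s))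
Consequence s = Pred Fm 0ℓ → Fm → Set s

FinDegree : ∀ c ℓ (k : ℕ) → List Fm → Fm → Set (lsuc (c ⊔ ℓ))
FinDegree c ℓ k [] α =
  (A : CAlgebra k c ℓ) → let open CAlgebra A in
  (v : ℕ → Carrier) → eval algebra v α ≈ 1#
FinDegree c ℓ k (α₁ ∷ αs) α =
  (A : CAlgebra k c ℓ) → let open CAlgebra A in
  (v : ℕ → Carrier) (x : Carrier) →
  All (λ β → x ≤ eval algebra v β) (α₁ ∷ αs) → x ≤ eval algebra v α

-- The list of premises used may be empty.  This agrees with the definition by
-- cases on Γ (empty, finite nonempty, infinite): see 𝕃≤-finite, which covers
-- the first two cases, and 𝕃≤-nonempty, which covers the last.
𝕃≤ : ∀ c ℓ (k : ℕ) → Consequence (lsuc (c ⊔ ℓ))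
𝕃≤ c ℓ k Γ α = ∃[ αs ] All Γ αs × FinDegree c ℓ k αs α

module _ {k : ℕ} {α : Fm} where

  private
    weaken : ∀ αs β βs → All (_∈ (β ∷ βs)) αs →
             FinDegree c ℓ k αs α → FinDegree c ℓ k (β ∷ βs) α
    weaken [] β βs _ valid A v x _ = trans (sym (∧-identityʳ x)) (∧-congˡ (sym (valid A v)))
      where
      open CAlgebra A
    weaken (_ ∷ _) β βs αs⊆ deg A v x x≤ = deg A v x (All.map (All.lookup x≤) αs⊆)

  𝕃≤-finite : ∀ αs → 𝕃≤ c ℓ k (_∈ αs) α ⇔ FinDegree c ℓ k αs α
  𝕃≤-finite [] = mk⇔
    (λ { ([] , _ , valid) → valid ; (_ ∷ _ , () ∷ _ , _) })
    (λ valid → [] , [] , valid)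
  𝕃≤-finite (β ∷ βs) = mk⇔
    (λ { (αs , αs⊆ , deg) → weaken αs β βs αs⊆ deg })
    (λ deg → β ∷ βs , All.tabulate (λ ∈ → ∈) , deg)

  𝕃≤-nonempty : ∀ {Γ : Pred Fm 0ℓ} → Satisfiable Γ →
    𝕃≤ c ℓ k Γ α ⇔ (∃[ β ] ∃[ βs ] All Γ (β ∷ βs) × FinDegree c ℓ k (β ∷ βs) α)
  𝕃≤-nonempty (γ , Γγ) = mk⇔
    (λ { ([] , _ , valid)     → γ , [] , Γγ ∷ [] , weaken [] γ [] [] valid
       ; (β ∷ βs , βs⊆ , deg) → β , βs , βs⊆ , deg })
    (λ { (β , βs , βs⊆ , deg) → β ∷ βs , βs⊆ , deg })

_⟨_,_⟩ : List Fm₂ → Fm → Fm → Pred Fm 0ℓ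
E ⟨ φ , ψ ⟩ = λ χ → χ ∈ map (_[ φ , ψ ]₂) E

private
  p q p₁ q₁ p₂ q₂ : Fm
  p  = var 0
  q  = var 1
  p₁ = var 0
  q₁ = var 1
  p₂ = var 2
  q₂ = var 3

record IsEquivalenceSet (_⊢_ : Consequence s) (E : List Fm₂) : Set s where
  field
    E1   : E ⟨ p , p ⟩ ⊆ (∅ ⊢_)
    E2   : (E ⟨ p , q ⟩ ∪ ｛ p ｝) ⊢ q
    E3-∧ : E ⟨ p₁ ∧ p₂ , q₁ ∧ q₂ ⟩ ⊆ ((E ⟨ p₁ , q₁ ⟩ ∪ E ⟨ p₂ , q₂ ⟩) ⊢_)
    E3-∨ : E ⟨ p₁ ∨ p₂ , q₁ ∨ q₂ ⟩ ⊆ ((E ⟨ p₁ , q₁ ⟩ ∪ E ⟨ p₂ , q₂ ⟩) ⊢_)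
    E3-∼ : E ⟨ ∼ p₁ , ∼ q₁ ⟩ ⊆ (E ⟨ p₁ , q₁ ⟩ ⊢_)
    E3-* : E ⟨ p₁ * , q₁ * ⟩ ⊆ (E ⟨ p₁ , q₁ ⟩ ⊢_)
    E3-t : E ⟨ t p₁ , t q₁ ⟩ ⊆ (E ⟨ p₁ , q₁ ⟩ ⊢_)
    E3-⊤ : E ⟨ ⊤ , ⊤ ⟩ ⊆ (∅ ⊢_)
    E3-⊥ : E ⟨ ⊥ , ⊥ ⟩ ⊆ (∅ ⊢_)

FinitelyEquivalential : Consequence s → Set s
FinitelyEquivalential _⊢_ = ∃[ E ] IsEquivalenceSet _⊢_ E

record IsFilter (_⊢_ : Consequence s) (A : Algebra a r)
                (F : Pred (Algebra.Carrier A) f) : Set (lsuc 0ℓ ⊔ s ⊔ a ⊔ r ⊔ f) where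
  open Algebra A
  field
    respects : ∀ {x y} → x ≈ y → F x → F y
    closed   : ∀ {Γ φ} → Γ ⊢ φ → (v : ℕ → Carrier) →
               (∀ {γ} → Γ γ → F (eval A v γ)) → F (eval A v φ)

-- Ω_A F always exists in universe a ⊔ f (see Ω-isLeibniz), so the
-- hypotheses on θF and θG below only name it.
Protoalgebraic : ∀ a r f → Consequence s → Set (s ⊔ lsuc (a ⊔ r ⊔ f))
Protoalgebraic a r f _⊢_ =
  (A : Algebra a r) (F G : Pred (Algebra.Carrier A) f) →
  IsFilter _⊢_ A F → IsFilter _⊢_ A G → F ⊆ G →
  (θF θG : Rel (Algebra.Carrier A) (a ⊔ f)) →
  IsLeibniz A F θF → IsLeibniz A G θG → θF ⇒ θG

Equation : Set → Set
Equation V = Term V × Term V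

EqConsequence : (Algebra a r → Set κ) → Pred (Equation ℕ) 0ℓ → Equation ℕ → Set (lsuc (a ⊔ r) ⊔ κ)
EqConsequence {a} {r} K Θ (φ , ψ) =
  (A : Algebra a r) → K A → let open Algebra A in
  (v : ℕ → Carrier) →
  (∀ {ε η} → Θ (ε , η) → eval A v ε ≈ eval A v η) → eval A v φ ≈ eval A v ψ

-- E(Γ) = { ε(γ) ≈ η(γ) : γ ∈ Γ, ε ≈ η ∈ E }
_⟦_⟧ : Pred (Equation (Fin 1)) 0ℓ → Pred Fm 0ℓ → Pred (Equation ℕ) 0ℓ
E ⟦ Γ ⟧ = λ eq →
  ∃[ γ ] Σ[ (ε , η) ∈ Equation (Fin 1) ] Γ γ × E (ε , η) × eq ≡ (ε [ γ ]₁ , η [ γ ]₁)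

-- Δ(φ,ψ) = { δ(φ,ψ) : δ ∈ Δ }
_⟪_,_⟫ : Pred Fm₂ 0ℓ → Fm → Fm → Pred Fm 0ℓ
Δ ⟪ φ , ψ ⟫ = λ χ → ∃[ d ] Δ d × χ ≡ d [ φ , ψ ]₂

record IsEquivalentAlgebraicSemantics
         (_⊢_ : Consequence s) (K : Algebra a r → Set κ)
         (Δ : Pred Fm₂ 0ℓ) (E : Pred (Equation (Fin 1)) 0ℓ)
         : Set (lsuc (0ℓ ⊔ a ⊔ r) ⊔ κ ⊔ s) where
  _⊨_ : Pred (Equation ℕ) 0ℓ → Equation ℕ → Set (lsuc (a ⊔ r) ⊔ κ)
  _⊨_ = EqConsequence K
  field
    completeness : ∀ Γ φ → (Γ ⊢ φ) ⇔ (E ⟦ ｛ φ ｝ ⟧ ⊆ ((E ⟦ Γ ⟧) ⊨_))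
    equivalence⇒ : ∀ φ ψ → E ⟦ Δ ⟪ φ , ψ ⟫ ⟧ ⊆ (｛ (φ , ψ) ｝ ⊨_)
    equivalence⇐ : ∀ φ ψ → (E ⟦ Δ ⟪ φ , ψ ⟫ ⟧) ⊨ (φ , ψ)

Algebraizable : ∀ a r κ → Consequence s → Set (s ⊔ lsuc (a ⊔ r ⊔ κ))
Algebraizable a r κ _⊢_ =
  Σ[ K ∈ (Algebra a r → Set κ) ] ∃[ Δ ] ∃[ E ] IsEquivalentAlgebraicSemantics _⊢_ K Δ E

{-# OPTIONS --safe #-}
module Submission where

-- Put △x = (∼x)* ∧ x.  The mpM axiom gives x ∧ ∼△x ≤ ∼x, so △x is complemented by
-- ∼△x.  Hence x ↔ y is a complemented element; it satisfies x ∧ (x ↔ y) ≤ y, and it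
-- lies above every complemented e with e ∧ x = e ∧ y, because "agreeing on e" is a
-- congruence and y ↔ y = 1.  So x ↔ y is the largest complemented element on which x
-- and y agree, and δ(x,y) the largest one on which t^i x and t^i y agree for all i;
-- this yields (E1)–(E3).
--
-- If F ⊆ G are filters, (E1) puts δ(x,y) into F whenever (x,y) ∈ ΩF, and then (E2)
-- makes ΩF compatible with G, so ΩF ⊆ ΩG.
--
-- An algebraizable logic satisfies p ⊣⊢ Δ(E(p)).  In the three-element chain 0 < ½ < 1
-- with t = id, the element ½ generates a filter whose Leibniz congruence is the
-- identity.  Thus p ⊢ Δ(E(p)) forces ½ to satisfy the equations E, hence Δ(E(½)) = 1,
-- and Δ(E(p)) ⊢ p then gives 1 ≤ ½.

open import Defs hiding (_∧_; _∨_; ∼_; _*; t)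
open import Algebra.Core using (Op₁; Op₂)
open import Algebra.Lattice.Bundles using (DistributiveLattice)
import Algebra.Lattice.Properties.DistributiveLattice as DistributiveLatticeProperties
open import Data.Fin.Base using (Fin; suc; opposite)
open import Data.Fin.Patterns using (0F; 1F; 2F)
open import Data.Fin.Properties using (all?; _≟_; opposite-involutive)
open import Data.List.Base using ([]; _∷_)
open import Data.List.Membership.Propositional using (_∈_)
open import Data.List.Membership.Propositional.Properties using (∈-map⁺; ∈-map⁻)
open import Data.List.Relation.Unary.All as All using ([]; _∷_)
open import Data.List.Relation.Unary.Any using (here)
open import Data.Nat.Base as ℕ using (ℕ; zero; suc; _≤_; _<_)
open import Data.Nat.GeneralisedArithmetic using (fold)
open import Data.Nat.Properties using (≤-refl; m≤n⇒m<n∨m≡n; m<1+n⇒m<n∨m≡n; m≤n⇒m≤1+n)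
open import Data.Product.Base using (_×_; _,_; ∃-syntax; proj₁)
open import Data.Sum.Base using (inj₁; inj₂; [_,_]′)
open import Data.Vec.Base using ([]; _∷_; lookup)
open import Function.Base using (id; _∘_; case_of_)
open import Function.Bundles using (mk⇔; Equivalence)
open import Level using (Level; 0ℓ; Lift; lift; lower)
open import Relation.Binary.Core using (Rel)
open import Relation.Binary.Lattice using (Lattice)
open import Relation.Binary.PropositionalEquality as ≡ using (_≡_; refl)
open import Relation.Binary.Structures using (IsEquivalence)
open import Relation.Nullary.Decidable using (toWitness; _→-dec_)
open import Relation.Nullary.Negation.Core using (¬_)
open import Relation.Unary using (Pred; _∪_; ∅; ｛_｝)

private variable
  a r e s c ℓ κ : Level
  V W : Set
  k : ℕ

-- Complemented elements and the biconditional in an mpM-algebra.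

module MpMProperties (M : MpMAlgebra c ℓ) where
  open MpMAlgebra M renaming (_≤_ to _⊑_)

  private
    distributiveLattice : DistributiveLattice c ℓ
    distributiveLattice = record { isDistributiveLattice = isDistributiveLattice }

  open DistributiveLatticeProperties distributiveLattice public
    using (∧-idem; ∨-idem; ∨-∧-orderTheoreticLattice)
  open Lattice ∨-∧-orderTheoreticLattice public
    using (x∧y≤x; x∧y≤y; ∧-greatest; x≤x∨y; y≤x∨y; ∨-least; antisym)
    renaming (reflexive to ⊑-reflexive; refl to ⊑-refl; trans to ⊑-trans)

  0⊑ : ∀ x → 0# ⊑ x
  0⊑ x = ⊑-trans (y≤x∨y x 0#) (⊑-reflexive (∨-identityʳ x))

  ⊑1 : ∀ x → x ⊑ 1#
  ⊑1 x = sym (∧-identityʳ x)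

  ∧-mono : ∀ {x x′ y y′} → x ⊑ x′ → y ⊑ y′ → x ∧ y ⊑ x′ ∧ y′
  ∧-mono p q = ∧-greatest (⊑-trans (x∧y≤x _ _) p) (⊑-trans (x∧y≤y _ _) q)

  ∧-∨-elim : ∀ {x y z w} → x ∧ y ⊑ w → x ∧ z ⊑ w → x ∧ (y ∨ z) ⊑ w
  ∧-∨-elim p q = ⊑-trans (⊑-reflexive (∧-distribˡ-∨ _ _ _)) (∨-least p q)

  ∼-∧ : ∀ x y → ∼ (x ∧ y) ≈ ∼ x ∨ ∼ y
  ∼-∧ x y = trans
    (∼-cong (sym (trans (∼-∨ (∼ x) (∼ y)) (∧-cong (∼-involutive x) (∼-involutive y)))))
    (∼-involutive (∼ x ∨ ∼ y))

  ∼-antitone : ∀ {x y} → x ⊑ y → ∼ y ⊑ ∼ x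
  ∼-antitone {x} {y} x⊑y =
    ⊑-trans (y≤x∨y (∼ x) (∼ y)) (⊑-reflexive (sym (trans (∼-cong x⊑y) (∼-∧ x y))))

  ⊑∼⇒⊑∼ : ∀ {x y} → x ⊑ ∼ y → y ⊑ ∼ x
  ⊑∼⇒⊑∼ {x} {y} p = ⊑-trans (⊑-reflexive (sym (∼-involutive y))) (∼-antitone p)

  x∧x*⊑0 : ∀ x → x ∧ x * ⊑ 0#
  x∧x*⊑0 x = ⊑-reflexive (Equivalence.from (*-pseudocompl x (x *)) ⊑-refl)

  *-greatest : ∀ {x y} → x ∧ y ⊑ 0# → y ⊑ x *
  *-greatest {x} {y} p = Equivalence.to (*-pseudocompl x y) (antisym p (0⊑ _))

  -- Applying `∼` to this inequality gives `1# ⊑ ∼ e ∨ e`, so `∼ e` is a lattice complement of `e`.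
  Complemented : Pred Carrier ℓ
  Complemented e = e ∧ ∼ e ⊑ 0#

  ∼-complemented : ∀ {e} → Complemented e → Complemented (∼ e)
  ∼-complemented {e} p =
    ⊑-trans (∧-greatest (⊑-trans (x∧y≤y _ _) (⊑-reflexive (∼-involutive e))) (x∧y≤x _ _)) p

  ∧-complemented : ∀ {e f} → Complemented e → Complemented f → Complemented (e ∧ f)
  ∧-complemented {e} {f} p q =
    ⊑-trans (∧-mono ⊑-refl (⊑-reflexive (∼-∧ e f)))
      (∧-∨-elim (⊑-trans (∧-mono (x∧y≤x e f) ⊑-refl) p)
                (⊑-trans (∧-mono (x∧y≤y e f) ⊑-refl) q))

  ∨-complemented : ∀ {e f} → Complemented e → Complemented f → Complemented (e ∨ f)
  ∨-complemented {e} {f} p q =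
    ⊑-trans (⊑-reflexive (∧-comm _ _))
      (∧-∨-elim (⊑-trans (∧-greatest (x∧y≤y _ _) (⊑-trans (x∧y≤x _ _) (∼-antitone (x≤x∨y e f)))) p)
                (⊑-trans (∧-greatest (x∧y≤y _ _) (⊑-trans (x∧y≤x _ _) (∼-antitone (y≤x∨y e f)))) q))

  -- The largest complemented element below `x`: if `e ⊑ x` is complemented, then
  -- `∼ x ∧ e ⊑ ∼ e ∧ e`, so `e ⊑ (∼ x) *`.
  △_ : Op₁ Carrier
  △ x = (∼ x) * ∧ x

  △x∧∼x⊑0 : ∀ x → △ x ∧ ∼ x ⊑ 0#
  △x∧∼x⊑0 x =
    ⊑-trans (∧-greatest (x∧y≤y _ _) (⊑-trans (x∧y≤x _ _) (x∧y≤x _ _))) (x∧x*⊑0 (∼ x))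

  -- By De Morgan, `∼ △ x` is `∼ (∼ x) * ∨ ∼ x`. The second joinand is immediate; the first is
  -- handled by `dual`, which is the mpM axiom at `∼ x` with `∼` applied to both sides.
  x∧∼△x⊑∼x : ∀ x → x ∧ ∼ △ x ⊑ ∼ x
  x∧∼△x⊑∼x x =
    ⊑-trans (∧-mono ⊑-refl (⊑-reflexive (∼-∧ _ _))) (∧-∨-elim dual (x∧y≤y _ _))
    where
    dual : x ∧ ∼ (∼ x) * ⊑ ∼ x
    dual = ⊑-trans
      (⊑-trans (∧-mono (⊑-reflexive (sym (∼-involutive x))) ⊑-refl)
               (⊑-reflexive (sym (∼-∨ _ _))))
      (∼-antitone (⊑-trans (⊑-trans (⊑-reflexive (sym (∼-involutive x))) (y≤x∨y _ _))
                           (x∨∼x≤x∨x* (∼ x))))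

  △-complemented : ∀ x → Complemented (△ x)
  △-complemented x =
    ⊑-trans (∧-greatest (x∧y≤x _ _)
                        (⊑-trans (∧-mono (x∧y≤y _ _) ⊑-refl) (x∧∼△x⊑∼x x)))
            (△x∧∼x⊑0 x)

  infixr 5 _⇒_ _⇿_
  -- The interpretations of `⟶` and `⟷`, to which their evaluation unfolds definitionally. Read
  -- `x ⇒ y` as the Boolean implication from `△ (x ∨ y)` to `△ (x ∧ y)`.
  _⇒_ _⇿_ : Op₂ Carrier
  x ⇒ y = ∼ △ (x ∨ y) ∨ △ (x ∧ y)
  x ⇿ y = (x ⇒ y) ∧ (∼ y ⇒ ∼ x)

  ⇿-complemented : ∀ x y → Complemented (x ⇿ y)
  ⇿-complemented x y = ∧-complemented (⇒-complemented x y) (⇒-complemented (∼ y) (∼ x))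
    where
    ⇒-complemented : ∀ x y → Complemented (x ⇒ y)
    ⇒-complemented x y =
      ∨-complemented (∼-complemented (△-complemented _)) (△-complemented _)

  -- Meeting `x` with the factor `x ⇒ y` yields `∼ y ∨ y`, and the contraposed factor then decides:
  -- its joinand `∼ △ (∼ y ∨ ∼ x)` sends `∼ y` below `y`, while `△ (∼ y ∧ ∼ x)` is disjoint from
  -- `x`.
  ⇿-mp : ∀ x y → (x ⇿ y) ∧ x ⊑ y
  ⇿-mp x y = ⊑-trans
    (∧-greatest (∧-greatest (x∧y≤y _ _) (⊑-trans (x∧y≤x _ _) (x∧y≤x _ _)))
                (⊑-trans (x∧y≤x _ _) (x∧y≤y _ _)))
    (∧-∨-elim
      (⊑-trans (∧-greatest (⊑-trans (x∧y≤x _ _) x∧⇒⊑∼y∨y) (x∧y≤y _ _)) ∼y∨y∧∼△⊑y)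
      (⊑-trans (⊑-trans (∧-greatest (x∧y≤y _ _) (⊑-trans (x∧y≤x _ _) (⊑-trans (x∧y≤x _ _) x⊑)))
                        (△x∧∼x⊑0 (∼ y ∧ ∼ x)))
               (0⊑ y)))
    where
    x⊑ : x ⊑ ∼ (∼ y ∧ ∼ x)
    x⊑ = ⊑∼⇒⊑∼ (x∧y≤y _ _)

    x∧⇒⊑∼y∨y : x ∧ (x ⇒ y) ⊑ ∼ y ∨ y
    x∧⇒⊑∼y∨y = ∧-∨-elim
      (⊑-trans (⊑-trans (∧-mono (x≤x∨y x y) ⊑-refl) (x∧∼△x⊑∼x (x ∨ y)))
               (⊑-trans (∼-antitone (y≤x∨y x y)) (x≤x∨y _ _)))
      (⊑-trans (⊑-trans (x∧y≤y _ _) (⊑-trans (x∧y≤y _ _) (x∧y≤y _ _))) (y≤x∨y _ _))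

    ∼y∨y∧∼△⊑y : (∼ y ∨ y) ∧ ∼ △ (∼ y ∨ ∼ x) ⊑ y
    ∼y∨y∧∼△⊑y = ⊑-trans (⊑-reflexive (∧-comm _ _)) (∧-∨-elim
      (⊑-trans (∧-greatest (⊑-trans (x∧y≤y _ _) (x≤x∨y _ _)) (x∧y≤x _ _))
      (⊑-trans (x∧∼△x⊑∼x (∼ y ∨ ∼ x))
      (⊑-trans (∼-antitone (x≤x∨y _ _)) (⊑-reflexive (∼-involutive y)))))
      (x∧y≤y _ _))

  △-cong : ∀ {x y} → x ≈ y → △ x ≈ △ y
  △-cong p = ∧-cong (*-cong (∼-cong p)) p

  ⇒-cong : ∀ {x x′ y y′} → x ≈ x′ → y ≈ y′ → x ⇒ y ≈ x′ ⇒ y′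
  ⇒-cong p q = ∨-cong (∼-cong (△-cong (∨-cong p q))) (△-cong (∧-cong p q))

  ⇿-cong : ∀ {x x′ y y′} → x ≈ x′ → y ≈ y′ → x ⇿ y ≈ x′ ⇿ y′
  ⇿-cong p q = ∧-cong (⇒-cong p q) (⇒-cong (∼-cong q) (∼-cong p))

  ⇿-comm : ∀ x y → x ⇿ y ≈ y ⇿ x
  ⇿-comm x y = ∧-cong (⇒-comm x y) (⇒-comm (∼ y) (∼ x))
    where
    ⇒-comm : ∀ x y → x ⇒ y ≈ y ⇒ x
    ⇒-comm x y = ∨-cong (∼-cong (△-cong (∨-comm x y))) (△-cong (∧-comm x y))

  -- By idempotence each factor has the form `∼ △ z ∨ △ z`, and `△ z` is complemented.
  1⊑x⇿x : ∀ x → 1# ⊑ x ⇿ x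
  1⊑x⇿x x = ∧-greatest (1⊑x⇒x x) (1⊑x⇒x (∼ x))
    where
    1⊑∼e∨e : ∀ {e} → Complemented e → 1# ⊑ ∼ e ∨ e
    1⊑∼e∨e {e} p =
      ⊑-trans (⊑∼⇒⊑∼ (⊑-trans p (0⊑ _)))
              (⊑-reflexive (trans (∼-∧ e (∼ e)) (∨-congˡ (∼-involutive e))))

    1⊑x⇒x : ∀ x → 1# ⊑ x ⇒ x
    1⊑x⇒x x =
      ⊑-trans (1⊑∼e∨e (△-complemented x))
              (⊑-reflexive (sym (∨-cong (∼-cong (△-cong (∨-idem x))) (△-cong (∧-idem x)))))

  -- Equivalent to `e ∧ x ≈ e ∧ y`. Splitting it into two inequalities lets each compatibility proof
  -- consist of one half and its mirror image.
  Agree : Carrier → Rel Carrier ℓ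
  Agree e x y = (e ∧ x ⊑ y) × (e ∧ y ⊑ x)

  ⇿-agree : ∀ x y → Agree (x ⇿ y) x y
  ⇿-agree x y = ⇿-mp x y , ⊑-trans (∧-mono (⊑-reflexive (⇿-comm x y)) ⊑-refl) (⇿-mp y x)

  agree-refl : ∀ {e x} → Agree e x x
  agree-refl = x∧y≤y _ _ , x∧y≤y _ _

  agree-antitone : ∀ {e f x y} → f ⊑ e → Agree e x y → Agree f x y
  agree-antitone f⊑e (p , q) =
    ⊑-trans (∧-mono f⊑e ⊑-refl) p , ⊑-trans (∧-mono f⊑e ⊑-refl) q

  ∧-agree : ∀ {e x x′ y y′} → Agree e x x′ → Agree e y y′ → Agree e (x ∧ y) (x′ ∧ y′)
  ∧-agree (p , p′) (q , q′) = half p q , half p′ q′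
    where
    half : ∀ {e x x′ y y′} → e ∧ x ⊑ x′ → e ∧ y ⊑ y′ → e ∧ (x ∧ y) ⊑ x′ ∧ y′
    half p q = ∧-greatest (⊑-trans (∧-mono ⊑-refl (x∧y≤x _ _)) p)
                          (⊑-trans (∧-mono ⊑-refl (x∧y≤y _ _)) q)

  ∨-agree : ∀ {e x x′ y y′} → Agree e x x′ → Agree e y y′ → Agree e (x ∨ y) (x′ ∨ y′)
  ∨-agree (p , p′) (q , q′) = half p q , half p′ q′
    where
    half : ∀ {e x x′ y y′} → e ∧ x ⊑ x′ → e ∧ y ⊑ y′ → e ∧ (x ∨ y) ⊑ x′ ∨ y′
    half p q = ∧-∨-elim (⊑-trans p (x≤x∨y _ _)) (⊑-trans q (y≤x∨y _ _))

  -- The pseudocomplement is antitone, so each half uses the opposite inequality: `y ∧ (e ∧ x *)`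
  -- lies below `x ∧ x *`.
  *-agree : ∀ {e x y} → Agree e x y → Agree e (x *) (y *)
  *-agree (p , q) = half q , half p
    where
    half : ∀ {e x y} → e ∧ y ⊑ x → e ∧ x * ⊑ y *
    half {x = x} p = *-greatest (⊑-trans
      (∧-greatest (⊑-trans (∧-greatest (⊑-trans (x∧y≤y _ _) (x∧y≤x _ _)) (x∧y≤x _ _)) p)
                  (⊑-trans (x∧y≤y _ _) (x∧y≤y _ _)))
      (x∧x*⊑0 x))

  module _ {e} (e-compl : Complemented e) where

    -- Complementedness of `e` enters here: `e ∧ ∼ x` lies below `e ∧ (∼ e ∨ ∼ y)`, and `e ∧ ∼ e`
    -- vanishes.
    ∼-agree : ∀ {x y} → Agree e x y → Agree e (∼ x) (∼ y)
    ∼-agree (p , q) = half q , half p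
      where
      half : ∀ {x y} → e ∧ y ⊑ x → e ∧ ∼ x ⊑ ∼ y
      half p = ⊑-trans (∧-mono ⊑-refl (⊑-trans (∼-antitone p) (⊑-reflexive (∼-∧ _ _))))
                       (∧-∨-elim (⊑-trans e-compl (0⊑ _)) (x∧y≤y _ _))

    -- Replacing `x` by `y` in one place of each factor shows that `x ⇿ x` and `x ⇿ y` agree on `e`,
    -- and `x ⇿ x` is the top element.
    agree⇒⊑⇿ : ∀ {x y} → Agree e x y → e ⊑ x ⇿ y
    agree⇒⊑⇿ {x} {y} x~y =
      ⊑-trans (∧-greatest ⊑-refl (⊑-trans (⊑1 e) (1⊑x⇿x x)))
              (proj₁ (∧-agree (⇒-agree agree-refl x~y) (⇒-agree (∼-agree x~y) agree-refl)))
      where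
      △-agree : ∀ {x y} → Agree e x y → Agree e (△ x) (△ y)
      △-agree p = ∧-agree (*-agree (∼-agree p)) p

      ⇒-agree : ∀ {x x′ y y′} → Agree e x x′ → Agree e y y′ → Agree e (x ⇒ y) (x′ ⇒ y′)
      ⇒-agree p q = ∨-agree (∼-agree (△-agree (∨-agree p q))) (△-agree (∧-agree p q))

  -- Take `e = x ⇿ y`: it is complemented and `x`, `y` agree on it, hence so do `h x`, `h y`, and
  -- maximality of `h x ⇿ h y` applies.
  ⇿-unary : {h : Op₁ Carrier} →
    (∀ {e x y} → Complemented e → Agree e x y → Agree e (h x) (h y)) →
    ∀ {x y} → x ⇿ y ⊑ h x ⇿ h y
  ⇿-unary h-agree {x} {y} = agree⇒⊑⇿ compl (h-agree compl (⇿-agree x y))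
    where
    compl : Complemented (x ⇿ y)
    compl = ⇿-complemented x y

  ⇿-binary : {_∙_ : Op₂ Carrier} →
    (∀ {e x x′ y y′} → Agree e x x′ → Agree e y y′ → Agree e (x ∙ y) (x′ ∙ y′)) →
    ∀ {x x′ y y′} → (x ⇿ x′) ∧ (y ⇿ y′) ⊑ (x ∙ y) ⇿ (x′ ∙ y′)
  ⇿-binary ∙-agree {x} {x′} {y} {y′} =
    agree⇒⊑⇿ (∧-complemented (⇿-complemented x x′) (⇿-complemented y y′))
      (∙-agree (agree-antitone (x∧y≤x _ _) (⇿-agree x x′))
               (agree-antitone (x∧y≤y _ _) (⇿-agree y y′)))

-- Evaluation of terms under substitution and modulo a congruence.

eval-subst : (A : Algebra a r) {v : W → Algebra.Carrier A} {σ : V → Term W} →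
  ∀ φ → eval A v (eval (Terms W) σ φ) ≡ eval A (eval A v ∘ σ) φ
eval-subst A (var x)      = refl
eval-subst A (φ Term.∧ ψ) = ≡.cong₂ (Algebra._∧_ A) (eval-subst A φ) (eval-subst A ψ)
eval-subst A (φ Term.∨ ψ) = ≡.cong₂ (Algebra._∨_ A) (eval-subst A φ) (eval-subst A ψ)
eval-subst A (Term.∼ φ)   = ≡.cong (Algebra.∼_ A) (eval-subst A φ)
eval-subst A (φ Term.*)   = ≡.cong (Algebra._* A) (eval-subst A φ)
eval-subst A (Term.t φ)   = ≡.cong (Algebra.t A) (eval-subst A φ)
eval-subst A ⊤            = refl
eval-subst A ⊥            = refl

module _ {A : Algebra a r} {θ : Rel (Algebra.Carrier A) e} (θ-cong : IsCongruence A θ) where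
  private
    module θ = IsCongruence θ-cong
    module θ≈ = IsEquivalence θ.isEquivalence

  eval-cong : {v w : V → Algebra.Carrier A} → (∀ x → θ (v x) (w x)) →
    ∀ φ → θ (eval A v φ) (eval A w φ)
  eval-cong v~w (var x)      = v~w x
  eval-cong v~w (φ Term.∧ ψ) = θ.∧-cong (eval-cong v~w φ) (eval-cong v~w ψ)
  eval-cong v~w (φ Term.∨ ψ) = θ.∨-cong (eval-cong v~w φ) (eval-cong v~w ψ)
  eval-cong v~w (Term.∼ φ)   = θ.∼-cong (eval-cong v~w φ)
  eval-cong v~w (φ Term.*)   = θ.*-cong (eval-cong v~w φ)
  eval-cong v~w (Term.t φ)   = θ.t-cong (eval-cong v~w φ)
  eval-cong v~w ⊤            = θ≈.refl
  eval-cong v~w ⊥            = θ≈.refl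

  eval-subst-cong : {v w : W → Algebra.Carrier A} {σ τ : V → Term W} →
    (∀ x → θ (eval A v (σ x)) (eval A w (τ x))) →
    ∀ φ → θ (eval A v (eval (Terms W) σ φ)) (eval A w (eval (Terms W) τ φ))
  eval-subst-cong σ~τ φ =
    ≡.subst₂ θ (≡.sym (eval-subst A φ)) (≡.sym (eval-subst A φ)) (eval-cong σ~τ φ)

  []₁-cong : {v w : ℕ → Algebra.Carrier A} {γ γ′ : Fm} →
    θ (eval A v γ) (eval A w γ′) → ∀ ε → θ (eval A v (ε [ γ ]₁)) (eval A w (ε [ γ′ ]₁))
  []₁-cong γ~γ′ = eval-subst-cong λ { 0F → γ~γ′ }

  -- The valuations on the two sides may differ, so an instance at compound formulas can be compared
  -- with the instance at variables naming their values.
  []₂-cong : {v w : ℕ → Algebra.Carrier A} {φ ψ φ′ ψ′ : Fm} →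
    θ (eval A v φ) (eval A w φ′) → θ (eval A v ψ) (eval A w ψ′) →
    ∀ d → θ (eval A v (d [ φ , ψ ]₂)) (eval A w (d [ φ′ , ψ′ ]₂))
  []₂-cong φ~φ′ ψ~ψ′ = eval-subst-cong λ { 0F → φ~φ′ ; 1F → ψ~ψ′ }

-- Iterates of the automorphism and the formula `δ`.

module CProperties (A : CAlgebra k c ℓ) where
  open CAlgebra A renaming (_≤_ to _⊑_; refl to ≈-refl)
  open MpMProperties mpMAlgebra public
  open IsMpMAutomorphism isAutomorphism

  t^ : ℕ → Op₁ Carrier
  t^ i x = fold x t i

  t^-unary : {h : Op₁ Carrier} → (∀ x → t (h x) ≈ h (t x)) →
    (∀ {x y} → x ≈ y → h x ≈ h y) → ∀ i x → t^ i (h x) ≈ h (t^ i x)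
  t^-unary h-homo h-cong zero    x = ≈-refl
  t^-unary h-homo h-cong (suc i) x = trans (cong (t^-unary h-homo h-cong i x)) (h-homo _)

  t^-binary : {_∙_ : Op₂ Carrier} → (∀ x y → t (x ∙ y) ≈ (t x ∙ t y)) →
    ∀ i x y → t^ i (x ∙ y) ≈ (t^ i x ∙ t^ i y)
  t^-binary ∙-homo zero    x y = ≈-refl
  t^-binary ∙-homo (suc i) x y = trans (cong (t^-binary ∙-homo i x y)) (∙-homo _ _)

  t^-t : ∀ i x → t^ i (t x) ≡ t^ (suc i) x
  t^-t zero    x = refl
  t^-t (suc i) x = ≡.cong t (t^-t i x)

  eval-fold : (w : V → Carrier) → ∀ i φ → eval algebra w (fold φ Term.t i) ≡ t^ i (eval algebra w φ)
  eval-fold w zero    φ = refl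
  eval-fold w (suc i) φ = ≡.cong t (eval-fold w i φ)

  ⋀-greatest : (w : V → Carrier) (f : ℕ → Term V) → ∀ n {x} →
    (∀ {i} → i < n → x ⊑ eval algebra w (f i)) → x ⊑ eval algebra w (⋀ n f)
  ⋀-greatest w f zero          h = ⊑1 _
  ⋀-greatest w f (suc zero)    h = h ≤-refl
  ⋀-greatest w f (suc (suc n)) h =
    ∧-greatest (⋀-greatest w f (suc n) (h ∘ m≤n⇒m≤1+n)) (h ≤-refl)

  ⋀-lower : (w : V → Carrier) (f : ℕ → Term V) → ∀ n {i} → i < n →
    eval algebra w (⋀ n f) ⊑ eval algebra w (f i)
  ⋀-lower w f (suc zero)    (ℕ.s≤s ℕ.z≤n) = ⊑-refl
  ⋀-lower w f (suc (suc n)) i<2+n =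
    [ (λ i<1+n → ⊑-trans (x∧y≤x _ _) (⋀-lower w f (suc n) i<1+n))
    , (λ { refl → x∧y≤y _ _ }) ]′ (m<1+n⇒m<n∨m≡n i<2+n)

  module _ {v : ℕ → Carrier} {φ ψ : Fm} where
    private
      w : Fin 2 → Carrier
      w = eval algebra v ∘ lookup (φ ∷ ψ ∷ [])

      factor : ∀ i → eval algebra w (fold (var 0F) Term.t i ⟷ fold (var 1F) Term.t i) ≡
                     (t^ i (eval algebra v φ) ⇿ t^ i (eval algebra v ψ))
      factor i = ≡.cong₂ _⇿_ (eval-fold w i (var 0F)) (eval-fold w i (var 1F))

      substitute : eval algebra v (δ k [ φ , ψ ]₂) ≡ eval algebra w (δ k)
      substitute = eval-subst algebra (δ k)

    -- Together with `δ-lower` this characterizes the value of `δ` as the meet of its factors; the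
    -- properties of `δ` below rest on these two facts.
    δ-greatest : ∀ {x} → (∀ {i} → i < k → x ⊑ t^ i (eval algebra v φ) ⇿ t^ i (eval algebra v ψ)) →
      x ⊑ eval algebra v (δ k [ φ , ψ ]₂)
    δ-greatest h = ≡.subst (_ ⊑_) (≡.sym substitute)
      (⋀-greatest w _ k λ {i} i<k → ≡.subst (_ ⊑_) (≡.sym (factor i)) (h i<k))

    δ-lower : ∀ {x} → x ⊑ eval algebra v (δ k [ φ , ψ ]₂) →
      ∀ {i} → i < k → x ⊑ t^ i (eval algebra v φ) ⇿ t^ i (eval algebra v ψ)
    δ-lower x⊑ {i} i<k = ≡.subst (_ ⊑_) (factor i)
      (⊑-trans (≡.subst (_ ⊑_) substitute x⊑) (⋀-lower w _ k i<k))

  module _ {v : ℕ → Carrier} where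

    δ-refl : ∀ φ → eval algebra v (δ k [ φ , φ ]₂) ≈ 1#
    δ-refl φ = antisym (⊑1 _) (δ-greatest {φ = φ} {φ} λ _ → 1⊑x⇿x _)

    δ-mp : 1 ≤ k → ∀ φ ψ {x} → x ⊑ eval algebra v (δ k [ φ , ψ ]₂) →
      x ⊑ eval algebra v φ → x ⊑ eval algebra v ψ
    δ-mp 1≤k φ ψ x⊑δ x⊑φ =
      -- The factor with `i = 0`, present because `1 ≤ k`, is the biconditional of `φ` and `ψ`
      -- themselves.
      ⊑-trans (∧-greatest (δ-lower {φ = φ} {ψ} x⊑δ 1≤k) x⊑φ) (⇿-mp _ _)

    -- Each `t^ i` commutes with the connective, so factor by factor the claim reduces to the
    -- compatibility of `⇿` with it. The cases of `∨`, `∼` and `*` follow the same pattern.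
    δ-∧ : ∀ φ φ′ ψ ψ′ {x} → x ⊑ eval algebra v (δ k [ φ , φ′ ]₂) →
      x ⊑ eval algebra v (δ k [ ψ , ψ′ ]₂) →
      x ⊑ eval algebra v (δ k [ φ Term.∧ ψ , φ′ Term.∧ ψ′ ]₂)
    δ-∧ φ φ′ ψ ψ′ p q = δ-greatest {φ = φ Term.∧ ψ} {φ′ Term.∧ ψ′} λ {i} i<k →
      ⊑-trans (∧-greatest (δ-lower {φ = φ} {φ′} p i<k) (δ-lower {φ = ψ} {ψ′} q i<k))
      (⊑-trans (⇿-binary ∧-agree)
               (⊑-reflexive (sym (⇿-cong (t^-binary ∧-homo i _ _) (t^-binary ∧-homo i _ _)))))

    δ-∨ : ∀ φ φ′ ψ ψ′ {x} → x ⊑ eval algebra v (δ k [ φ , φ′ ]₂) →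
      x ⊑ eval algebra v (δ k [ ψ , ψ′ ]₂) →
      x ⊑ eval algebra v (δ k [ φ Term.∨ ψ , φ′ Term.∨ ψ′ ]₂)
    δ-∨ φ φ′ ψ ψ′ p q = δ-greatest {φ = φ Term.∨ ψ} {φ′ Term.∨ ψ′} λ {i} i<k →
      ⊑-trans (∧-greatest (δ-lower {φ = φ} {φ′} p i<k) (δ-lower {φ = ψ} {ψ′} q i<k))
      (⊑-trans (⇿-binary ∨-agree)
               (⊑-reflexive (sym (⇿-cong (t^-binary ∨-homo i _ _) (t^-binary ∨-homo i _ _)))))

    δ-∼ : ∀ φ ψ {x} → x ⊑ eval algebra v (δ k [ φ , ψ ]₂) →
      x ⊑ eval algebra v (δ k [ Term.∼ φ , Term.∼ ψ ]₂)
    δ-∼ φ ψ p = δ-greatest {φ = Term.∼ φ} {Term.∼ ψ} λ {i} i<k →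
      ⊑-trans (δ-lower {φ = φ} {ψ} p i<k)
      (⊑-trans (⇿-unary λ compl → ∼-agree compl)
               (⊑-reflexive (sym (⇿-cong (t^-unary ∼-homo ∼-cong i _)
                                         (t^-unary ∼-homo ∼-cong i _)))))

    δ-* : ∀ φ ψ {x} → x ⊑ eval algebra v (δ k [ φ , ψ ]₂) →
      x ⊑ eval algebra v (δ k [ φ Term.* , ψ Term.* ]₂)
    δ-* φ ψ p = δ-greatest {φ = φ Term.*} {ψ Term.*} λ {i} i<k →
      ⊑-trans (δ-lower {φ = φ} {ψ} p i<k)
      (⊑-trans (⇿-unary λ _ → *-agree)
               (⊑-reflexive (sym (⇿-cong (t^-unary *-homo *-cong i _)
                                         (t^-unary *-homo *-cong i _)))))

    -- The last factor wraps around to the first because t^k = id.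
    δ-t : ∀ φ ψ {x} → x ⊑ eval algebra v (δ k [ φ , ψ ]₂) →
      x ⊑ eval algebra v (δ k [ Term.t φ , Term.t ψ ]₂)
    δ-t φ ψ {x} p = δ-greatest {φ = Term.t φ} {Term.t ψ} λ {i} i<k →
      ≡.subst (x ⊑_) (≡.sym (≡.cong₂ _⇿_ (t^-t i _) (t^-t i _))) (shift i<k)
      where
      shift : ∀ {i} → i < k →
        x ⊑ t^ (suc i) (eval algebra v φ) ⇿ t^ (suc i) (eval algebra v ψ)
      shift {i} i<k with m≤n⇒m<n∨m≡n i<k
      ... | inj₁ 1+i<k = δ-lower {φ = φ} {ψ} p 1+i<k
      ... | inj₂ refl  =
        ⊑-trans (δ-lower {φ = φ} {ψ} p (ℕ.s≤s ℕ.z≤n))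
                (⊑-reflexive (sym (⇿-cong (t^k≈id _) (t^k≈id _))))

-- Equivalentiality and protoalgebraicity.

δ-isEquivalenceSet : ∀ c ℓ → 1 ≤ k → IsEquivalenceSet (𝕃≤ c ℓ k) (δ k ∷ [])
δ-isEquivalenceSet c ℓ 1≤k = record
  { E1   = λ { (here refl) → [] , [] , λ A v → CProperties.δ-refl A (var 0) }
  ; E2   = _ , inj₁ (here refl) ∷ inj₂ refl ∷ [] ,
           λ { A v x (p ∷ q ∷ []) → CProperties.δ-mp A 1≤k (var 0) (var 1) p q }
  ; E3-∧ = λ { (here refl) → _ , inj₁ (here refl) ∷ inj₂ (here refl) ∷ [] ,
           λ { A v x (p ∷ q ∷ []) → CProperties.δ-∧ A (var 0) (var 1) (var 2) (var 3) p q } }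
  ; E3-∨ = λ { (here refl) → _ , inj₁ (here refl) ∷ inj₂ (here refl) ∷ [] ,
           λ { A v x (p ∷ q ∷ []) → CProperties.δ-∨ A (var 0) (var 1) (var 2) (var 3) p q } }
  ; E3-∼ = λ { (here refl) → _ , here refl ∷ [] ,
           λ { A v x (p ∷ []) → CProperties.δ-∼ A (var 0) (var 1) p } }
  ; E3-* = λ { (here refl) → _ , here refl ∷ [] ,
           λ { A v x (p ∷ []) → CProperties.δ-* A (var 0) (var 1) p } }
  ; E3-t = λ { (here refl) → _ , here refl ∷ [] ,
           λ { A v x (p ∷ []) → CProperties.δ-t A (var 0) (var 1) p } }
  ; E3-⊤ = λ { (here refl) → [] , [] , λ A v → CProperties.δ-refl A ⊤ }
  ; E3-⊥ = λ { (here refl) → [] , [] , λ A v → CProperties.δ-refl A ⊥ }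
  }

-- Since `θG` is the largest congruence compatible with `G`, it is enough that `θF` be compatible
-- with `G`.
equivalenceSet⇒protoalgebraic : ∀ {_⊢_ : Consequence s} {E} → IsEquivalenceSet _⊢_ E →
  ∀ a r f → Protoalgebraic a r f _⊢_
equivalenceSet⇒protoalgebraic {E = E} E-eq a r f A F G F-filter G-filter F⊆G θF θG ΩF ΩG =
  IsLeibniz.largest ΩG θF F.isCongruence θF-compatible-G
  where
  open Algebra A using (Carrier)
  module F = IsLeibniz ΩF
  open IsEquivalence (IsCongruence.isEquivalence F.isCongruence) using () renaming (refl to θF-refl)
  open IsEquivalenceSet E-eq

  assign : Carrier → Carrier → ℕ → Carrier
  assign x y 0       = x
  assign x y (suc _) = y

  θF⇒F-E : ∀ {x y} → θF x y → ∀ {d} → d ∈ E → F (eval A (assign x y) (d [ var 0 , var 1 ]₂))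
  θF⇒F-E {x} {y} x~y {d} d∈E =
    -- (E1) puts the value of `d` at `x`, `x` into `F`; moving the second argument to `y` along `θF`
    -- stays inside `F`.
    F.compatible
      ([]₂-cong F.isCongruence {v = assign x y} {φ = var 0} {ψ = var 0} {var 0} {var 1}
                θF-refl x~y d)
      (IsFilter.closed F-filter (E1 (∈-map⁺ _ d∈E)) (assign x y) λ ())

  θF-compatible-G : Compatible θF G
  θF-compatible-G {x} {y} x~y Gx = IsFilter.closed G-filter E2 (assign x y) λ where
    (inj₁ γ∈) → let (d , d∈E , eq) = ∈-map⁻ _ γ∈ in
      ≡.subst (G ∘ eval A (assign x y)) (≡.sym eq) (F⊆G (θF⇒F-E x~y d∈E))
    (inj₂ refl) → Gx

-- Consequences of having an equivalent algebraic semantics.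

module AlgebraizableProperties
  {_⊢_ : Consequence s} {K : Algebra a r → Set κ} {Δ E}
  (S : IsEquivalentAlgebraicSemantics _⊢_ K Δ E) where
  open IsEquivalentAlgebraicSemantics S

  Δ-refl : ∀ φ {d} → Δ d → ∅ ⊢ (d [ φ , φ ]₂)
  Δ-refl φ {d} Δd = Equivalence.from (completeness _ _) λ where
    (_ , _ , refl , Eε , refl) A KA v _ →
      equivalence⇒ φ φ (_ , _ , (d , Δd , refl) , Eε , refl) A KA v
        λ { refl → IsEquivalence.refl (Algebra.isEquivalence A) }

  -- On the equational side, the equations for `Δ` give `φ ≈ ψ`, hence `α ≈ β`, and this carries the
  -- defining equations from `α` to `β`.
  Δ-detach : ∀ {φ ψ α β} → ｛ (φ , ψ) ｝ ⊨ (α , β) → ((Δ ⟪ φ , ψ ⟫) ∪ ｛ α ｝) ⊢ β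
  Δ-detach {φ} {ψ} {α} {β} α≈β = Equivalence.from (completeness _ _) λ where
    (_ , (ε , η) , refl , Eε , refl) A KA v hyp →
      let open IsEquivalence (Algebra.isEquivalence A) using (sym; trans)
          φ≈ψ = equivalence⇐ φ ψ A KA v
                  λ { (γ , eq , Δγ , rest) → hyp (γ , eq , inj₁ Δγ , rest) }
          ~   = α≈β A KA v λ { refl → φ≈ψ }
          at  = []₁-cong (≈-isCongruence A) {v = v} {γ = α} {β} ~
      in trans (sym (at ε)) (trans (hyp (α , (ε , η) , inj₂ refl , Eε , refl)) (at η))

  -- One direction of the interderivability of `φ` with Δ(E(φ)), the other being `Δ⇒truth`: under
  -- `completeness` both sides express that `φ` satisfies the defining equations.
  truth⇒Δ : ∀ φ {ε η d} → E (ε , η) → Δ d → ｛ φ ｝ ⊢ (d [ ε [ φ ]₁ , η [ φ ]₁ ]₂)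
  truth⇒Δ φ {ε} {η} {d} Eε Δd = Equivalence.from (completeness _ _) λ where
    (_ , _ , refl , Eε′ , refl) A KA v hyp →
      equivalence⇒ (ε [ φ ]₁) (η [ φ ]₁) (_ , _ , (d , Δd , refl) , Eε′ , refl) A KA v
        λ { refl → hyp (φ , (ε , η) , refl , Eε , refl) }

  ΔE : Fm → Pred Fm 0ℓ
  ΔE φ χ = ∃[ ε ] ∃[ η ] E (ε , η) × (Δ ⟪ ε [ φ ]₁ , η [ φ ]₁ ⟫) χ

  Δ⇒truth : ∀ φ → ΔE φ ⊢ φ
  Δ⇒truth φ = Equivalence.from (completeness _ _) λ where
    (_ , (ε , η) , refl , Eε , refl) A KA v hyp →
      equivalence⇐ (ε [ φ ]₁) (η [ φ ]₁) A KA v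
        λ { (γ , eq , Δγ , rest) → hyp (γ , eq , (ε , η , Eε , Δγ) , rest) }

-- Every principal up-set is closed under the logic; a derivation from no premises gives the value
-- `1#`, which lies above any `x`.
𝕃≤-sound : ∀ {Γ φ} → 𝕃≤ c ℓ k Γ φ →
  (A : CAlgebra k c ℓ) → let open CAlgebra A renaming (_≤_ to _⊑_) in
  ∀ v x → (∀ {γ} → Γ γ → x ⊑ eval algebra v γ) → x ⊑ eval algebra v φ
𝕃≤-sound ([] , _ , valid) A v x _ =
  ⊑-trans (⊑1 x) (⊑-reflexive (CAlgebra.sym A (valid A v)))
  where open CProperties A
𝕃≤-sound (_ ∷ _ , Γαs , deg) A v x hyp = deg A v x (All.map hyp Γαs)

-- The three-element chain as an mpM-algebra, its laws decided by exhausting cases.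

module Three where
  infixr 7 _∧_
  infixr 6 _∨_
  infix  9 _*

  -- `0F`, `1F`, `2F` stand for 0 < ½ < 1. Meet is the minimum, `opposite` is the De Morgan negation
  -- fixing ½, and join is the dual of meet.
  _∧_ _∨_ : Op₂ (Fin 3)
  0F ∧ y  = 0F
  1F ∧ 0F = 0F
  1F ∧ y  = 1F
  2F ∧ y  = y
  x ∨ y = opposite (opposite x ∧ opposite y)

  _* : Op₁ (Fin 3)
  0F *    = 2F
  suc _ * = 0F

  ∧-comm : ∀ x y → x ∧ y ≡ y ∧ x
  ∧-comm = toWitness {a? = all? λ x → all? λ y → x ∧ y ≟ y ∧ x} _

  ∧-assoc : ∀ x y z → (x ∧ y) ∧ z ≡ x ∧ (y ∧ z)
  ∧-assoc = toWitness {a? = all? λ x → all? λ y → all? λ z → (x ∧ y) ∧ z ≟ x ∧ (y ∧ z)} _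

  ∨-comm : ∀ x y → x ∨ y ≡ y ∨ x
  ∨-comm = toWitness {a? = all? λ x → all? λ y → x ∨ y ≟ y ∨ x} _

  ∨-assoc : ∀ x y z → (x ∨ y) ∨ z ≡ x ∨ (y ∨ z)
  ∨-assoc = toWitness {a? = all? λ x → all? λ y → all? λ z → (x ∨ y) ∨ z ≟ x ∨ (y ∨ z)} _

  ∨-absorbs-∧ : ∀ x y → x ∨ (x ∧ y) ≡ x
  ∨-absorbs-∧ = toWitness {a? = all? λ x → all? λ y → x ∨ (x ∧ y) ≟ x} _

  ∧-absorbs-∨ : ∀ x y → x ∧ (x ∨ y) ≡ x
  ∧-absorbs-∨ = toWitness {a? = all? λ x → all? λ y → x ∧ (x ∨ y) ≟ x} _

  ∨-distribˡ-∧ : ∀ x y z → x ∨ (y ∧ z) ≡ (x ∨ y) ∧ (x ∨ z)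
  ∨-distribˡ-∧ = toWitness
    {a? = all? λ x → all? λ y → all? λ z → x ∨ (y ∧ z) ≟ (x ∨ y) ∧ (x ∨ z)} _

  ∨-distribʳ-∧ : ∀ x y z → (y ∧ z) ∨ x ≡ (y ∨ x) ∧ (z ∨ x)
  ∨-distribʳ-∧ = toWitness
    {a? = all? λ x → all? λ y → all? λ z → (y ∧ z) ∨ x ≟ (y ∨ x) ∧ (z ∨ x)} _

  ∧-distribˡ-∨ : ∀ x y z → x ∧ (y ∨ z) ≡ (x ∧ y) ∨ (x ∧ z)
  ∧-distribˡ-∨ = toWitness
    {a? = all? λ x → all? λ y → all? λ z → x ∧ (y ∨ z) ≟ (x ∧ y) ∨ (x ∧ z)} _

  ∧-distribʳ-∨ : ∀ x y z → (y ∨ z) ∧ x ≡ (y ∧ x) ∨ (z ∧ x)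
  ∧-distribʳ-∨ = toWitness
    {a? = all? λ x → all? λ y → all? λ z → (y ∨ z) ∧ x ≟ (y ∧ x) ∨ (z ∧ x)} _

  ∧-identityʳ : ∀ x → x ∧ 2F ≡ x
  ∧-identityʳ = toWitness {a? = all? λ x → x ∧ 2F ≟ x} _

  ∨-identityʳ : ∀ x → x ∨ 0F ≡ x
  ∨-identityʳ = toWitness {a? = all? λ x → x ∨ 0F ≟ x} _

  opposite-∨ : ∀ x y → opposite (x ∨ y) ≡ opposite x ∧ opposite y
  opposite-∨ = toWitness {a? = all? λ x → all? λ y → opposite (x ∨ y) ≟ opposite x ∧ opposite y} _

  *-pseudocompl⇒ : ∀ x y → x ∧ y ≡ 0F → y ≡ y ∧ x *
  *-pseudocompl⇒ = toWitness
    {a? = all? λ x → all? λ y → (x ∧ y ≟ 0F) →-dec (y ≟ y ∧ x *)} _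

  *-pseudocompl⇐ : ∀ x y → y ≡ y ∧ x * → x ∧ y ≡ 0F
  *-pseudocompl⇐ = toWitness
    {a? = all? λ x → all? λ y → (y ≟ y ∧ x *) →-dec (x ∧ y ≟ 0F)} _

  x∨∼x≤x∨x* : ∀ x → x ∨ opposite x ≡ (x ∨ opposite x) ∧ (x ∨ x *)
  x∨∼x≤x∨x* = toWitness {a? = all? λ x → x ∨ opposite x ≟ (x ∨ opposite x) ∧ (x ∨ x *)} _

three : ∀ c ℓ → MpMAlgebra c ℓ
three c ℓ = record
  { Carrier = Lift c (Fin 3)
  ; _≈_ = λ x y → Lift ℓ (lower x ≡ lower y)
  ; _∧_ = λ x y → lift (lower x ∧ lower y)
  ; _∨_ = λ x y → lift (lower x ∨ lower y)
  ; ∼_ = λ x → lift (opposite (lower x))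
  ; _* = λ x → lift (lower x *)
  ; 1# = lift 2F
  ; 0# = lift 0F
  ; isDeMorganAlgebra = record
    { isDistributiveLattice = record
      { isLattice = record
        { isEquivalence = record
          { refl = lift refl
          ; sym = λ (lift p) → lift (≡.sym p)
          ; trans = λ (lift p) (lift q) → lift (≡.trans p q)
          }
        ; ∨-comm = λ (lift x) (lift y) → lift (∨-comm x y)
        ; ∨-assoc = λ (lift x) (lift y) (lift z) → lift (∨-assoc x y z)
        ; ∨-cong = λ (lift p) (lift q) → lift (≡.cong₂ _∨_ p q)
        ; ∧-comm = λ (lift x) (lift y) → lift (∧-comm x y)
        ; ∧-assoc = λ (lift x) (lift y) (lift z) → lift (∧-assoc x y z)
        ; ∧-cong = λ (lift p) (lift q) → lift (≡.cong₂ _∧_ p q)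
        ; absorptive = (λ (lift x) (lift y) → lift (∨-absorbs-∧ x y))
                     , (λ (lift x) (lift y) → lift (∧-absorbs-∨ x y))
        }
      ; ∨-distrib-∧ = (λ (lift x) (lift y) (lift z) → lift (∨-distribˡ-∧ x y z))
                    , (λ (lift x) (lift y) (lift z) → lift (∨-distribʳ-∧ x y z))
      ; ∧-distrib-∨ = (λ (lift x) (lift y) (lift z) → lift (∧-distribˡ-∨ x y z))
                    , (λ (lift x) (lift y) (lift z) → lift (∧-distribʳ-∨ x y z))
      }
    ; ∧-identityʳ = λ (lift x) → lift (∧-identityʳ x)
    ; ∨-identityʳ = λ (lift x) → lift (∨-identityʳ x)
    ; ∼-cong = λ (lift p) → lift (≡.cong opposite p)
    ; ∼-involutive = λ (lift x) → lift (opposite-involutive x)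
    ; ∼-∨ = λ (lift x) (lift y) → lift (opposite-∨ x y)
    }
  ; *-cong = λ (lift p) → lift (≡.cong _* p)
  ; *-pseudocompl = λ (lift x) (lift y) → mk⇔
      (λ (lift p) → lift (*-pseudocompl⇒ x y p)) (λ (lift p) → lift (*-pseudocompl⇐ x y p))
  ; x∨∼x≤x∨x* = λ (lift x) → lift (x∨∼x≤x∨x* x)
  }
  where open Three

-- The identity satisfies `t^k = id` for every `k`, so a single chain refutes algebraizability for
-- all `k`.
trivialAction : ∀ k → MpMAlgebra c ℓ → CAlgebra k c ℓ
trivialAction k M = record
  { mpMAlgebra = M
  ; t = id
  ; isAutomorphism = record
    { cong = id
    ; ∧-homo = λ _ _ → ≈-refl
    ; ∨-homo = λ _ _ → ≈-refl
    ; ∼-homo = λ _ → ≈-refl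
    ; *-homo = λ _ → ≈-refl
    ; 1#-homo = ≈-refl
    ; 0#-homo = ≈-refl
    ; bijective = id , λ y → y , id
    }
  ; t^k≈id = fold-id k
  }
  where
  open MpMAlgebra M renaming (refl to ≈-refl)
  fold-id : ∀ n x → fold x id n ≈ x
  fold-id zero    x = ≈-refl
  fold-id (suc n) x = fold-id n x

-- Failure of algebraizability.

𝕃≤-not-algebraizable : ∀ c ℓ a r κ k → ¬ Algebraizable a r κ (𝕃≤ c ℓ k)
𝕃≤-not-algebraizable c ℓ a r κ k (K , Δ , E , S) =
  -- As `½` satisfies the equations E, each member of Δ(E(½)) takes the same value as an instance
  -- with equal arguments, namely `1#`. The resulting `1# ⊑ ½` is absurd.
  case 𝕃≤-sound (Δ⇒truth p) A v½ 1# (λ where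
    (ε , η , Eε , d , Δd , refl) →
      ⊑-trans (𝕃≤-sound (Δ-refl (η [ p ]₁) Δd) A v½ 1# λ ())
              (⊑-reflexive ([]₂-cong (≈-isCongruence algebra) {v = v½} {v½}
                 {η [ p ]₁} {η [ p ]₁} {ε [ p ]₁} {η [ p ]₁}
                 (sym (½-satisfies-E Eε)) ≈-refl d)))
  of λ { (lift ()) }
  where
  A : CAlgebra k c ℓ
  A = trivialAction k (three c ℓ)

  open CAlgebra A renaming (_≤_ to _⊑_; refl to ≈-refl)
  open CProperties A using (⊑-trans; ⊑-reflexive)
  open AlgebraizableProperties S

  p q : Fm
  p = var 0
  q = var 1

  ½ : Carrier
  ½ = lift 1F

  v½ : ℕ → Carrier
  v½ _ = ½

  -- The filter generated by `½` is {½, 1}. It contains only `∼ x` for x = 0, both `x` and `∼ x` for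
  -- x = ½, and only `x` for x = 1, so these two memberships determine `x`.
  filter-separates : ∀ x y → (½ ⊑ x → ½ ⊑ y) → (½ ⊑ y → ½ ⊑ x) →
    (½ ⊑ ∼ x → ½ ⊑ ∼ y) → (½ ⊑ ∼ y → ½ ⊑ ∼ x) → x ≈ y
  filter-separates (lift 0F) (lift 0F) _ _ _ _ = lift refl
  filter-separates (lift 0F) (lift 1F) _ g _ _ = case g (lift refl) of λ { (lift ()) }
  filter-separates (lift 0F) (lift 2F) _ g _ _ = case g (lift refl) of λ { (lift ()) }
  filter-separates (lift 1F) (lift 0F) f _ _ _ = case f (lift refl) of λ { (lift ()) }
  filter-separates (lift 1F) (lift 1F) _ _ _ _ = lift refl
  filter-separates (lift 1F) (lift 2F) _ _ f _ = case f (lift refl) of λ { (lift ()) }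
  filter-separates (lift 2F) (lift 0F) f _ _ _ = case f (lift refl) of λ { (lift ()) }
  filter-separates (lift 2F) (lift 1F) _ _ _ g = case g (lift refl) of λ { (lift ()) }
  filter-separates (lift 2F) (lift 2F) _ _ _ _ = lift refl

  -- `Δ-detach` transports membership in the filter between `p` and `q`, and between `∼ p` and
  -- `∼ q`, in both directions.
  Δ-in-filter⇒≈ : ∀ v → (∀ {d} → Δ d → ½ ⊑ eval algebra v (d [ p , q ]₂)) → v 0 ≈ v 1
  Δ-in-filter⇒≈ v ½⊑Δ = filter-separates (v 0) (v 1)
    (transfer {p} {q} λ B KB w eqs → eqs refl)
    (transfer {q} {p} λ B KB w eqs → IsEquivalence.sym (Algebra.isEquivalence B) (eqs refl))
    (transfer {Term.∼ p} {Term.∼ q} λ B KB w eqs → Algebra.∼-cong B (eqs refl))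
    (transfer {Term.∼ q} {Term.∼ p} λ B KB w eqs →
      Algebra.∼-cong B (IsEquivalence.sym (Algebra.isEquivalence B) (eqs refl)))
    where
    transfer : ∀ {α β} → EqConsequence K ｛ (p , q) ｝ (α , β) →
      ½ ⊑ eval algebra v α → ½ ⊑ eval algebra v β
    transfer {α} {β} α≈β ½⊑α = 𝕃≤-sound (Δ-detach {p} {q} {α} {β} α≈β) A v ½ λ where
      (inj₁ (d , Δd , refl)) → ½⊑Δ Δd
      (inj₂ refl)            → ½⊑α

  ½-satisfies-E : ∀ {ε η} → E (ε , η) →
    eval algebra v½ (ε [ p ]₁) ≈ eval algebra v½ (η [ p ]₁)
  ½-satisfies-E {ε} {η} Eε = Δ-in-filter⇒≈ w λ {d} Δd →
    ⊑-trans (𝕃≤-sound (truth⇒Δ p Eε Δd) A v½ ½ λ { refl → lift refl })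
            (⊑-reflexive ([]₂-cong (≈-isCongruence algebra) {v = v½} {w}
               {ε [ p ]₁} {η [ p ]₁} {p} {q} ≈-refl ≈-refl d))
    where
    -- The values of both sides of the equation at `½` are assigned to the variables `p` and `q`,
    -- where `Δ-in-filter⇒≈` applies.
    w : ℕ → Carrier
    w 0       = eval algebra v½ (ε [ p ]₁)
    w (suc _) = eval algebra v½ (η [ p ]₁)

theorem6p12 : ∀ {c ℓ a r f κ : Level} (k : ℕ) → 1 ≤ k →
    FinitelyEquivalential (𝕃≤ c ℓ k)
    × IsEquivalenceSet (𝕃≤ c ℓ k) (δ k ∷ [])
    × Protoalgebraic a r f (𝕃≤ c ℓ k)
    × ¬ Algebraizable a r κ (𝕃≤ c ℓ k)
theorem6p12 {c} {ℓ} {a} {r} {f} {κ} k 1≤k =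
  (δ k ∷ [] , E-eq) , E-eq , equivalenceSet⇒protoalgebraic E-eq a r f ,
  𝕃≤-not-algebraizable c ℓ a r κ k
  where
  E-eq : IsEquivalenceSet (𝕃≤ c ℓ k) (δ k ∷ [])
  E-eq = δ-isEquivalenceSet c ℓ 1≤k
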